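{- Let $P$ be a poset whose order is the intersection of finitely many scattered linear orders on the underlying set of $P$. Then $P$ contains no isomorphic copy (as an induced subposet) of any of the posets $\eta$, $T_2$, $\Omega(\eta)$, $B(\check{\eta})$, $B(\check{T_2})$, $B(\check{\Omega}(\eta))$, nor of any of their duals.
   Context: A poset (or its order) is scattered if it contains no induced subposet isomorphic to the chain $\eta$ of rational numbers. The dual $P^*$ of a poset $P$ is the same set with the reversed order. $\eta$ denotes the chain $(\mathbb{Q},\leq)$. $T_2$ is the infinite binary tree: the set of finite $0$-$1$ sequences (including the empty one), ordered by $s\leq t$ iff $s$ is an initial segment of $t$ (so the root is the least element). $\Omega(\eta)$ is the infinite binary tree in which each level is totally ordered increasingly from left to right: its underlying set is the set of finite $0$-$1$ sequences, and its order is the least order containing the order of $T_2$ and, for sequences of equal length, the lexicographic order ($0<1$). Equivalently, $\Omega(\eta)$ is isomorphic to $\{(n, m/2^n): n,m\in\mathbb{N},\ 0\leq m<2^n\}$ ordered by $(n,a)\leq(n',a')$ iff $n\leq n'$ and $a\leq a'$. For a poset $P$, the open split $B(\check{P})$ is the poset on $P\times\{0,1\}$ with strict order $(x,i)<(y,j)$ iff $i<j$ and $x<y$ in $P$. $B(\check{\Omega}(\eta))$ is the open split of $\Omega(\eta)$. -}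

module Defs where

open import Data.Bool.Base using (Bool; _<_)
import Data.Bool.Properties as Bool
open import Data.List.Base using (List; []; _∷_; length)
open import Data.List.Relation.Binary.Lex.Strict using (Lex-≤; ≤-isPartialOrder)
open import Data.List.Relation.Binary.Pointwise using (≡⇒Pointwise-≡; Pointwise-≡⇒≡)
open import Data.List.Relation.Binary.Prefix.Heterogeneous using (Prefix)
open import Data.List.Relation.Binary.Prefix.Heterogeneous.Properties using (length-mono; toPointwise)
import Data.List.Relation.Binary.Prefix.Homogeneous.Properties as Prefix
open import Data.Nat.Base using (_≤_)
import Data.Nat.Properties as ℕ
open import Data.Product.Base using (_×_; _,_; ∃)
open import Data.Product.Relation.Binary.Pointwise.NonDependent using (×-strictPartialOrder)
open import Data.Rational.Properties using (≤-decTotalOrder)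
open import Data.Sum.Base using (inj₁; inj₂)
open import Level using (Level; 0ℓ; _⊔_)
open import Relation.Binary.Bundles using (DecTotalOrder; Poset)
open import Relation.Binary.Construct.Closure.ReflexiveTransitive using (Star; ε; _◅_; _◅◅_)
open import Relation.Binary.Construct.Union using (_∪_)
open import Relation.Binary.Core using (Rel)
open import Relation.Binary.Morphism.Structures using (IsOrderMonomorphism)
import Relation.Binary.Properties.Poset as PosetProperties
import Relation.Binary.Properties.StrictPartialOrder as StrictPartialOrderProperties
open import Relation.Binary.PropositionalEquality using (_≡_; refl; isEquivalence; isPreorder)
open import Relation.Binary.Structures using (IsPartialOrder; IsTotalOrder)
open import Relation.Nullary.Negation using (¬_)

private
  variable
    a ℓ₁ ℓ₂ b ℓ₃ ℓ₄ : Level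

infix 4 _↪_

-- Q ↪ P : some induced subposet of P (the image of the map) is isomorphic to Q.
_↪_ : Poset a ℓ₁ ℓ₂ → Poset b ℓ₃ ℓ₄ → Set (a ⊔ ℓ₁ ⊔ ℓ₂ ⊔ b ⊔ ℓ₃ ⊔ ℓ₄)
Q ↪ P = ∃ (IsOrderMonomorphism Q._≈_ P._≈_ Q._≤_ P._≤_)
  where
  module Q = Poset Q
  module P = Poset P

dual : Poset a ℓ₁ ℓ₂ → Poset a ℓ₁ ℓ₂
dual = PosetProperties.≥-poset

η : Poset 0ℓ 0ℓ 0ℓ
η = DecTotalOrder.poset ≤-decTotalOrder

Scattered : Poset a ℓ₁ ℓ₂ → Set (a ⊔ ℓ₁ ⊔ ℓ₂)
Scattered P = ¬ (η ↪ P)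

record IsScatteredLinearOrder {A : Set a} (_≈_ : Rel A ℓ₁) (_⊑_ : Rel A ℓ₂)
                              : Set (a ⊔ ℓ₁ ⊔ ℓ₂) where
  field
    isTotalOrder : IsTotalOrder _≈_ _⊑_

  open IsTotalOrder isTotalOrder public using (isPartialOrder)

  field
    scattered : Scattered (record { isPartialOrder = isPartialOrder })

Word : Set
Word = List Bool

_⊑ᵖ_ : Rel Word 0ℓ
_⊑ᵖ_ = Prefix _≡_

T₂ : Poset 0ℓ 0ℓ 0ℓ
T₂ = record
  { Carrier        = Word
  ; _≈_            = _≡_
  ; _≤_            = _⊑ᵖ_
  ; isPartialOrder = record
    { isPreorder = record
      { isEquivalence = isEquivalence
      ; reflexive     = λ s≡t → P.reflexive (≡⇒Pointwise-≡ s≡t)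
      ; trans         = P.trans
      }
    ; antisym = λ s⊑t t⊑s → Pointwise-≡⇒≡ (P.antisym s⊑t t⊑s)
    }
  }
  where
  ≡-isPartialOrder : IsPartialOrder {A = Bool} _≡_ _≡_
  ≡-isPartialOrder = record { isPreorder = isPreorder ; antisym = λ x≡y _ → x≡y }

  module P = IsPartialOrder (Prefix.isPartialOrder ≡-isPartialOrder)

_≤ˡᵉˣ_ : Rel Word 0ℓ
_≤ˡᵉˣ_ = Lex-≤ _≡_ _<_

_≤ˡᵉᵛᵉˡ_ : Rel Word 0ℓ
s ≤ˡᵉᵛᵉˡ t = length s ≡ length t × s ≤ˡᵉˣ t

-- The reflexive transitive closure is antisymmetric (≤Ω-antisym below), so it
-- is the least partial order containing both relations.
_≤Ω_ : Rel Word 0ℓ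
_≤Ω_ = Star (_⊑ᵖ_ ∪ _≤ˡᵉᵛᵉˡ_)

private
  module Lex = IsPartialOrder (≤-isPartialOrder Bool.<-isStrictPartialOrder)

≤Ω⇒length-≤ : ∀ {s t} → s ≤Ω t → length s ≤ length t
≤Ω⇒length-≤ ε                      = ℕ.≤-refl
≤Ω⇒length-≤ (inj₁ s⊑u ◅ u≤t)       = ℕ.≤-trans (length-mono s⊑u) (≤Ω⇒length-≤ u≤t)
≤Ω⇒length-≤ (inj₂ (eq , _) ◅ u≤t)  = ℕ.≤-trans (ℕ.≤-reflexive eq) (≤Ω⇒length-≤ u≤t)

≤Ω⇒≤ˡᵉˣ : ∀ {s t} → s ≤Ω t → length t ≤ length s → s ≤ˡᵉˣ t
≤Ω⇒≤ˡᵉˣ ε _ = Lex.reflexive (≡⇒Pointwise-≡ refl)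
≤Ω⇒≤ˡᵉˣ (inj₁ s⊑u ◅ u≤t) ∣t∣≤∣s∣ =
  Lex.trans (Lex.reflexive (toPointwise ∣s∣≡∣u∣ s⊑u))
            (≤Ω⇒≤ˡᵉˣ u≤t (ℕ.≤-trans ∣t∣≤∣s∣ (length-mono s⊑u)))
  where
  ∣s∣≡∣u∣ = ℕ.≤-antisym (length-mono s⊑u) (ℕ.≤-trans (≤Ω⇒length-≤ u≤t) ∣t∣≤∣s∣)
≤Ω⇒≤ˡᵉˣ (inj₂ (∣s∣≡∣u∣ , s≤u) ◅ u≤t) ∣t∣≤∣s∣ =
  Lex.trans s≤u (≤Ω⇒≤ˡᵉˣ u≤t (ℕ.≤-trans ∣t∣≤∣s∣ (ℕ.≤-reflexive ∣s∣≡∣u∣)))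

≤Ω-antisym : ∀ {s t} → s ≤Ω t → t ≤Ω s → s ≡ t
≤Ω-antisym s≤t t≤s = Pointwise-≡⇒≡ (Lex.antisym
  (≤Ω⇒≤ˡᵉˣ s≤t (≤Ω⇒length-≤ t≤s))
  (≤Ω⇒≤ˡᵉˣ t≤s (≤Ω⇒length-≤ s≤t)))

Ωη : Poset 0ℓ 0ℓ 0ℓ
Ωη = record
  { Carrier        = Word
  ; _≈_            = _≡_
  ; _≤_            = _≤Ω_
  ; isPartialOrder = record
    { isPreorder = record
      { isEquivalence = isEquivalence
      ; reflexive     = λ { refl → ε }
      ; trans         = _◅◅_
      }
    ; antisym = ≤Ω-antisym
    }
  }

-- The strict order is the componentwise product of x < y (that is, x ≤ y and
-- ¬ x ≈ y) with false < true; the order adjoins equality of pairs to it.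
openSplit : Poset a ℓ₁ ℓ₂ → Poset a ℓ₁ (ℓ₁ ⊔ ℓ₂)
openSplit P = StrictPartialOrderProperties.poset
  (×-strictPartialOrder (PosetProperties.<-strictPartialOrder P) Bool.<-strictPartialOrder)

obstructions : List (Poset 0ℓ 0ℓ 0ℓ)
obstructions = η ∷ T₂ ∷ Ωη ∷ openSplit η ∷ openSplit T₂ ∷ openSplit Ωη ∷ []

{-# OPTIONS --safe #-}
-- Each obstruction Q carries maps lower, upper from the binary words with lower s < upper t for s a
-- strict prefix of t, but lower (s1) ≰ upper t for t extending s0.  In a scattered chain L, every
-- word extends to a word s such that for all x, t above s some extension of t has a prefix z with
-- lower x ≤ lower z; otherwise, above some word, each s would have extensions t, x with everything
-- above t strictly below lower x, and the resulting binary search tree embeds ℚ in L.  Handling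
-- finitely many chains one after another yields t extending s0 with lower (s1) ≤ lower z ≤ upper t
-- in all of them, that is, in P.
module Submission where

open import Defs
open import Axiom.ExcludedMiddle using (ExcludedMiddle)
open import Data.Bool.Base using (true; false; f<t)
open import Data.Fin.Base using (Fin; zero; suc)
open import Data.Integer.Base using (ℤ; _⊖_; -[1+_]) renaming (+_ to pos)
open import Data.List.Base using ([]; _∷_; _∷ʳ_)
open import Data.List.Relation.Binary.Lex.Strict using (base; halt; this; next)
open import Data.List.Relation.Binary.Prefix.Heterogeneous using ([]; _∷_; _++ᵖ_)
open import Data.List.Relation.Unary.All using (All; []; _∷_)
open import Data.Nat.Base using (ℕ; zero; suc; s≤s; _+_; _≤′_; ≤′-refl; ≤′-step)
import Data.Nat.Properties as ℕ
open import Data.Product.Base using (_×_; _,_; ∃; ∃₂; proj₁; proj₂)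
import Data.Rational.Base as ℚ
open ℚ using (ℚ; mkℚ; 0ℚ; 1ℚ)
import Data.Rational.Properties as ℚ
open import Data.Sum.Base using (_⊎_; inj₁; inj₂; [_,_]′)
open import Function.Base using (_∘_; flip)
open import Function.Bundles using (_⇔_; Equivalence)
open import Level using (Level; 0ℓ; _⊔_; Lift; lift)
open import Relation.Binary.Bundles using (Poset)
open import Relation.Binary.Core using (Rel)
import Relation.Binary.Construct.Closure.ReflexiveTransitive as Star
import Relation.Binary.Construct.Flip.EqAndOrd as Flip
open import Relation.Binary.Definitions using (tri<; tri≈; tri>)
open import Relation.Binary.Morphism.Structures using (IsOrderMonomorphism)
open import Relation.Binary.PropositionalEquality
  using (_≡_; _≢_; refl; sym; trans; cong)
open import Relation.Binary.Structures using (IsTotalOrder)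
open import Relation.Nullary.Decidable.Core using (yes; no; map′; decidable-stable)
open import Relation.Nullary.Negation using (¬_; contradiction)

private
  variable
    a ℓ ℓ₁ ℓ₂ ℓ₃ : Level

-- Enumeration of the rationals

-- Cantor's walk along each antidiagonal from `(m , 0)` to `(0 , m)`, then on to the next.
nextPair : ℕ × ℕ → ℕ × ℕ
nextPair (zero  , n) = suc n , zero
nextPair (suc m , n) = m , suc n

pair : ℕ → ℕ × ℕ
pair zero    = zero , zero
pair (suc k) = nextPair (pair k)

pair-antidiagonal : ∀ m n {k} → pair k ≡ (m + n , zero) → pair (n + k) ≡ (m , n)
pair-antidiagonal m zero    eq = trans eq (cong (_, zero) (ℕ.+-identityʳ m))
pair-antidiagonal m (suc n) eq =
  cong nextPair (pair-antidiagonal (suc m) n (trans eq (cong (_, zero) (ℕ.+-suc m n))))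

pair-axis : ∀ n → ∃ λ k → pair k ≡ (n , zero)
pair-axis zero    = zero , refl
pair-axis (suc n) with k , eq ← pair-axis n = suc (n + k) , cong nextPair (pair-antidiagonal zero n eq)

pair-surjective : ∀ m n → ∃ λ k → pair k ≡ (m , n)
pair-surjective m n with k , eq ← pair-axis (m + n) = n + k , pair-antidiagonal m n eq

difference : ℕ × ℕ → ℤ
difference (m , n) = m ⊖ n

fraction : ℕ × ℕ → ℚ
fraction (i , d) = difference (pair i) ℚ./ suc d

enum : ℕ → ℚ
enum k = fraction (pair k)

difference-surjective : ∀ z → ∃ λ i → difference (pair i) ≡ z
difference-surjective (pos n)  with i , eq ← pair-surjective n zero       = i , cong difference eq
difference-surjective -[1+ n ] with i , eq ← pair-surjective zero (suc n) = i , cong difference eq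

enum-surjective : ∀ q → ∃ λ k → enum k ≡ q
enum-surjective q@(mkℚ z d _)
  with i , refl ← difference-surjective z
  with k , eq ← pair-surjective i d = k , trans (cong fraction eq) (ℚ.↥p/↧p≡p q)

index : ℚ → ℕ
index q = proj₁ (enum-surjective q)

-- Embeddings of η in total orders

module _ {A : Set a} {_≈_ : Rel A ℓ₁} {_≤_ : Rel A ℓ₂} (O : IsTotalOrder _≈_ _≤_) where

  private module O = IsTotalOrder O

  -- Linearity of `ℚ` turns the negative hypothesis into order reflection, and totality of `_≤_`
  -- turns it into monotonicity.
  strictlyMonotone⇒η↪ : (f : ℚ → A) → (∀ {p q} → p ℚ.< q → ¬ (f q ≤ f p)) →
                        η ↪ record { isPartialOrder = O.isPartialOrder }
  strictlyMonotone⇒η↪ f f-strict = f , record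
    { isOrderHomomorphism = record
      { cong = O.Eq.reflexive ∘ cong f
      ; mono = f-mono
      }
    ; injective = λ fp≈fq → ℚ.≤-antisym (f-cancel (O.reflexive fp≈fq))
                                        (f-cancel (O.reflexive (O.Eq.sym fp≈fq)))
    ; cancel = f-cancel
    }
    where
    f-cancel : ∀ {p q} → f p ≤ f q → p ℚ.≤ q
    f-cancel fp≤fq = ℚ.≮⇒≥ λ q<p → f-strict q<p fp≤fq

    f-mono : ∀ {p q} → p ℚ.≤ q → f p ≤ f q
    f-mono {p} {q} p≤q with ℚ.<-cmp p q
    ... | tri< p<q _ _  = [ (λ fp≤fq → fp≤fq) , flip contradiction (f-strict p<q) ]′ (O.total (f p) (f q))
    ... | tri≈ _ refl _ = O.refl
    ... | tri> _ _ q<p  = contradiction (ℚ.<-≤-trans q<p p≤q) (ℚ.<-irrefl refl)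

-- Search trees for the rationals

module SearchTree
  {A : Set a} (_≤_ : Rel A ℓ₂)
  {N : Set} (_⊑_ : Rel N 0ℓ) (⊑-refl : ∀ {s} → s ⊑ s) (⊑-trans : ∀ {s t u} → s ⊑ t → t ⊑ u → s ⊑ u)
  (key : N → A)
  where

  -- Separation is asked of everything above the two nodes, so that it persists along paths.
  _◁_ : Rel N ℓ₂
  s ◁ t = ∀ {u v} → s ⊑ u → t ⊑ v → ¬ (key v ≤ key u)

  ◁-up : ∀ {s t s′ t′} → s ⊑ s′ → t ⊑ t′ → s ◁ t → s′ ◁ t′
  ◁-up s⊑s′ t⊑t′ s◁t s′⊑u t′⊑v = s◁t (⊑-trans s⊑s′ s′⊑u) (⊑-trans t⊑t′ t′⊑v)

  module Tree
    (root : N) (left mid right : N → N)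
    (⊑-left : ∀ s → s ⊑ left s) (⊑-mid : ∀ s → s ⊑ mid s) (⊑-right : ∀ s → s ⊑ right s)
    (left◁mid : ∀ s → left s ◁ mid s) (left◁right : ∀ s → left s ◁ right s)
    (mid◁right : ∀ s → mid s ◁ right s)
    where

    child : ℚ → ℚ → N → N
    child r q s with ℚ.<-cmp q r
    ... | tri< _ _ _ = left s
    ... | tri≈ _ _ _ = mid s
    ... | tri> _ _ _ = right s

    ⊑-child : ∀ r q s → s ⊑ child r q s
    ⊑-child r q s with ℚ.<-cmp q r
    ... | tri< _ _ _ = ⊑-left s
    ... | tri≈ _ _ _ = ⊑-mid s
    ... | tri> _ _ _ = ⊑-right s

    -- The inequations rule out the first alternative at the step where the pivot `r` is `p` or `q`
    -- itself.
    child-≡⊎◁ : ∀ r {p q} s → p ℚ.< q →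
                (child r p s ≡ child r q s × r ≢ p × r ≢ q) ⊎ child r p s ◁ child r q s
    child-≡⊎◁ r {p} {q} s p<q with ℚ.<-cmp p r | ℚ.<-cmp q r
    ... | tri< _ p≢r _ | tri< _ q≢r _ = inj₁ (refl , p≢r ∘ sym , q≢r ∘ sym)
    ... | tri< _ _ _   | tri≈ _ _ _   = inj₂ (left◁mid s)
    ... | tri< _ _ _   | tri> _ _ _   = inj₂ (left◁right s)
    ... | tri≈ _ _ _   | tri> _ _ _   = inj₂ (mid◁right s)
    ... | tri> _ p≢r _ | tri> _ q≢r _ = inj₁ (refl , p≢r ∘ sym , q≢r ∘ sym)
    ... | tri≈ _ refl _ | tri< q<r _ _ = contradiction q<r (ℚ.<-asym p<q)
    ... | tri≈ _ refl _ | tri≈ _ refl _ = contradiction p<q (ℚ.<-irrefl refl)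
    ... | tri> _ _ r<p | tri< q<r _ _  = contradiction (ℚ.<-trans r<p p<q) (ℚ.<-asym q<r)
    ... | tri> _ _ r<p | tri≈ _ refl _ = contradiction r<p (ℚ.<-asym p<q)

    path : ℕ → ℚ → N
    path zero    q = root
    path (suc k) q = child (enum k) q (path k q)

    path-mono : ∀ {j k} q → j ≤′ k → path j q ⊑ path k q
    path-mono             q ≤′-refl       = ⊑-refl
    path-mono {k = suc k} q (≤′-step j≤k) = ⊑-trans (path-mono q j≤k) (⊑-child (enum k) q (path k q))

    path-step : ∀ {p q} → p ℚ.< q → ∀ k →
                (path (suc k) p ≡ path (suc k) q × enum k ≢ p × enum k ≢ q) ⊎
                path (suc k) p ◁ path (suc k) q
    path-≡⊎◁  : ∀ {p q} → p ℚ.< q → ∀ k → path k p ≡ path k q ⊎ path k p ◁ path k q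

    path-step {p} {q} p<q k with path-≡⊎◁ p<q k
    ... | inj₁ eq rewrite eq = child-≡⊎◁ (enum k) (path k q) p<q
    ... | inj₂ sep = inj₂ (◁-up (⊑-child (enum k) p (path k p)) (⊑-child (enum k) q (path k q)) sep)

    path-≡⊎◁ p<q zero    = inj₁ refl
    path-≡⊎◁ p<q (suc k) = [ inj₁ ∘ proj₁ , inj₂ ]′ (path-step p<q k)

    -- Of two rationals p < q, the one enumerated first sends both to different children at its own
    -- comparison, if they have not parted before.
    location : ℚ → N
    location q = path (suc (index q)) q

    location-strict : ∀ {p q} → p ℚ.< q → ¬ (key (location q) ≤ key (location p))
    location-strict {p} {q} p<q
      with ℕ.≤-total (index p) (index q) | path-step p<q (index p) | path-step p<q (index q)
    ... | _        | inj₁ (_ , ≢p , _) | _                 = contradiction (proj₂ (enum-surjective p)) ≢p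
    ... | _        | _                 | inj₁ (_ , _ , ≢q) = contradiction (proj₂ (enum-surjective q)) ≢q
    -- `sep` holds at the level of `location p`, and `location q` lies above the node of `q` on that
    -- level.
    ... | inj₁ i≤j | inj₂ sep          | _                 = sep ⊑-refl (path-mono q (ℕ.≤⇒≤′ (s≤s i≤j)))
    ... | inj₂ j≤i | _                 | inj₂ sep          = sep (path-mono p (ℕ.≤⇒≤′ (s≤s j≤i))) ⊑-refl

-- The prefix order

module ⊑ᵖ = Poset T₂

_⊏_ : Rel Word 0ℓ
s ⊏ t = ∃ λ b → (s ∷ʳ b) ⊑ᵖ t

⊑-∷ʳ : ∀ s {b} → s ⊑ᵖ (s ∷ʳ b)
⊑-∷ʳ s = ⊑ᵖ.refl ++ᵖ _

⊏⇒⊑ : ∀ {s t} → s ⊏ t → s ⊑ᵖ t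
⊏⇒⊑ {s} (_ , sb⊑t) = ⊑ᵖ.trans (⊑-∷ʳ s) sb⊑t

⊏-⊑-trans : ∀ {s t u} → s ⊏ t → t ⊑ᵖ u → s ⊏ u
⊏-⊑-trans (b , sb⊑t) t⊑u = b , ⊑ᵖ.trans sb⊑t t⊑u

⊏-irrefl : ∀ {s} → ¬ (s ⊏ s)
⊏-irrefl {x ∷ s} (b , _ ∷ sb⊑s) = ⊏-irrefl (b , sb⊑s)

⊏⇒≢ : ∀ {s t} → s ⊏ t → s ≢ t
⊏⇒≢ s⊏t refl = ⊏-irrefl s⊏t

siblings-disjoint : ∀ s {t} → (s ∷ʳ false) ⊑ᵖ t → ¬ ((s ∷ʳ true) ⊑ᵖ t)
siblings-disjoint []      (refl ∷ _)    (() ∷ _)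
siblings-disjoint (x ∷ s) (_ ∷ s0⊑t) (_ ∷ s1⊑t) = siblings-disjoint s s0⊑t s1⊑t

-- A finite Baire argument: the properties are met one after another, and upward closure keeps those
-- already met.
common-extension : ∀ n (G : Fin n → Word → Set ℓ) → (∀ i {s t} → s ⊑ᵖ t → G i s → G i t) →
                   ∀ r → (∀ i {s} → r ⊑ᵖ s → ∃ λ t → s ⊑ᵖ t × G i t) →
                   ∃ λ t → r ⊑ᵖ t × ∀ i → G i t
common-extension zero    G up r dense = r , ⊑ᵖ.refl , λ ()
common-extension (suc n) G up r dense =
  let s , r⊑s , g  = dense zero ⊑ᵖ.refl
      t , s⊑t , gs = common-extension n (G ∘ suc) (up ∘ suc) s λ i s⊑u → dense (suc i) (⊑ᵖ.trans r⊑s s⊑u)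
  in  t , ⊑ᵖ.trans r⊑s s⊑t , λ { zero → up zero s⊑t g ; (suc i) → gs i }

-- Labellings of the binary tree in scattered chains

module _ {A : Set a} (_≤_ : Rel A ℓ) (f : Word → A) where

  -- The prefix `z` is proper because a `Fork` gives `lower z ≤ upper y` only then.
  Overtakes : Word → Word → Set ℓ
  Overtakes x y = ∃ λ z → z ⊏ y × f x ≤ f z

  Recurrent : Word → Set ℓ
  Recurrent s = ∀ {x t} → s ⊑ᵖ x → s ⊑ᵖ t → ∃ λ y → t ⊑ᵖ y × Overtakes x y

  -- The classical negation of `Recurrent`, with its quantifiers moved inward.
  Splits : Word → Set ℓ
  Splits s = ∃₂ λ t x → s ⊑ᵖ t × s ⊑ᵖ x × (∀ {y z} → t ⊑ᵖ y → z ⊏ y → ¬ (f x ≤ f z))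

  Overtakes-up : ∀ {x s t} → s ⊑ᵖ t → Overtakes x s → Overtakes x t
  Overtakes-up s⊑t (z , z⊏s , x≤z) = z , ⊏-⊑-trans z⊏s s⊑t , x≤z

  Recurrent-up : ∀ {s t} → s ⊑ᵖ t → Recurrent s → Recurrent t
  Recurrent-up s⊑t rec t⊑x t⊑u = rec (⊑ᵖ.trans s⊑t t⊑x) (⊑ᵖ.trans s⊑t t⊑u)

module _ {A : Set a} {_≈_ : Rel A ℓ₁} {_≤_ : Rel A ℓ₂} (O : IsTotalOrder _≈_ _≤_) (f : Word → A) where

  private module O = IsTotalOrder O

  -- The key of `s` makes a cut: nodes above `lo s` have smaller keys, nodes above `hi′ s` larger
  -- ones. Cutting the upper part again gives the three children of a search tree.
  everywhereSplits⇒η↪ : ∀ r → (∀ {s} → r ⊑ᵖ s → Splits _≤_ f s) →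
                        η ↪ record { isPartialOrder = O.isPartialOrder }
  everywhereSplits⇒η↪ r splits = strictlyMonotone⇒η↪ O (key ∘ location) location-strict
    where
    N : Set
    N = ∃ (r ⊑ᵖ_)

    _⊑_ : Rel N 0ℓ
    s ⊑ t = proj₁ s ⊑ᵖ proj₁ t

    -- lo s and hi s are the t and x of Splits; since Splits only speaks of proper prefixes, the nodes
    -- whose keys all exceed the key of s are those above the child hi′ s of hi s.
    lo hi hi′ : N → N
    lo (s , r⊑s) = let t , _ , s⊑t , _ = splits r⊑s in t , ⊑ᵖ.trans r⊑s s⊑t
    hi (s , r⊑s) = let _ , x , _ , s⊑x , _ = splits r⊑s in x , ⊑ᵖ.trans r⊑s s⊑x
    hi′ s = let x , r⊑x = hi s in x ∷ʳ false , ⊑ᵖ.trans r⊑x (⊑-∷ʳ x)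

    ⊑-lo : ∀ s → s ⊑ lo s
    ⊑-lo (_ , r⊑s) = let _ , _ , s⊑t , _ = splits r⊑s in s⊑t

    ⊑-hi : ∀ s → s ⊑ hi s
    ⊑-hi (_ , r⊑s) = let _ , _ , _ , s⊑x , _ = splits r⊑s in s⊑x

    ⊑-hi′ : ∀ s → s ⊑ hi′ s
    ⊑-hi′ s = ⊑ᵖ.trans (⊑-hi s) (⊑-∷ʳ (proj₁ (hi s)))

    key : N → A
    key s = f (proj₁ (hi s))

    above-lo : ∀ s {y z} → proj₁ (lo s) ⊑ᵖ y → z ⊏ y → ¬ (key s ≤ f z)
    above-lo (_ , r⊑s) = let _ , _ , _ , _ , x≰ = splits r⊑s in x≰

    lo<key : ∀ s {u} → lo s ⊑ u → ¬ (key s ≤ key u)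
    lo<key s {u} lo⊑u =
      -- `hi u`, whose label is the key of `u`, is a proper prefix of `hi′ u`.
      above-lo s (⊑ᵖ.trans lo⊑u (⊑-hi′ u)) (false , ⊑ᵖ.refl)

    key<hi′ : ∀ s {u} → hi′ s ⊑ u → ¬ (key u ≤ key s)
    -- The roles are exchanged: the splitting at `u` is applied to `hi s`, a proper prefix of
    -- `lo u`.
    key<hi′ s {u} hi′⊑u = above-lo u ⊑ᵖ.refl (false , ⊑ᵖ.trans hi′⊑u (⊑-lo u))

    open SearchTree _≤_ _⊑_ ⊑ᵖ.refl ⊑ᵖ.trans key

    lo◁hi′ : ∀ s → lo s ◁ hi′ s
    lo◁hi′ s {u} {v} lo⊑u hi′⊑v v≤u =
      [ key<hi′ s hi′⊑v , (λ s≤v → lo<key s lo⊑u (O.trans s≤v v≤u)) ]′ (O.total (key v) (key s))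

    open Tree (r , ⊑ᵖ.refl) lo (lo ∘ hi′) (hi′ ∘ hi′)
      ⊑-lo
      (λ s → ⊑ᵖ.trans (⊑-hi′ s) (⊑-lo (hi′ s)))
      (λ s → ⊑ᵖ.trans (⊑-hi′ s) (⊑-hi′ (hi′ s)))
      (λ s → ◁-up {lo s} {hi′ s} {lo s} {lo (hi′ s)} ⊑ᵖ.refl (⊑-lo (hi′ s)) (λ {u} {v} → lo◁hi′ s {u} {v}))
      (λ s → ◁-up {lo s} {hi′ s} {lo s} {hi′ (hi′ s)} ⊑ᵖ.refl (⊑-hi′ (hi′ s)) (λ {u} {v} → lo◁hi′ s {u} {v}))
      (λ s {u} {v} → lo◁hi′ (hi′ s) {u} {v})

module _ {A : Set a} {_≈_ : Rel A ℓ₁} {_≤_ : Rel A ℓ₂} (em : ExcludedMiddle ℓ₂)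
         (S : IsScatteredLinearOrder _≈_ _≤_) (f : Word → A) where

  open IsScatteredLinearOrder S using (isTotalOrder; scattered)

  ¬Splits⇒Recurrent : ∀ {s} → ¬ Splits _≤_ f s → Recurrent _≤_ f s
  ¬Splits⇒Recurrent ¬split {x} {t} s⊑x s⊑t = decidable-stable em λ ¬overtaken →
    ¬split (t , x , s⊑t , s⊑x , λ t⊑y z⊏y x≤z → ¬overtaken (_ , t⊑y , _ , z⊏y , x≤z))

  recurrent-dense : ∀ r → ∃ λ s → r ⊑ᵖ s × Recurrent _≤_ f s
  recurrent-dense r with em {∃ λ s → r ⊑ᵖ s × ¬ Splits _≤_ f s}
  ... | yes (s , r⊑s , ¬split) = s , r⊑s , ¬Splits⇒Recurrent ¬split
  ... | no  all-split = contradiction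
    (everywhereSplits⇒η↪ isTotalOrder f r λ r⊑s → decidable-stable em λ ¬split → all-split (_ , r⊑s , ¬split))
    scattered

-- Forks in the obstructions

-- The fields compare only a `lower` with an `upper`, and `lower≉upper` makes the positive
-- comparisons strict, so that the notion passes to open splits.
record Fork (Q : Poset a ℓ₁ ℓ₂) : Set (a ⊔ ℓ₁ ⊔ ℓ₂) where
  open Poset Q
  field
    lower upper : Word → Carrier
    lower≤upper : ∀ {s t} → s ⊏ t → lower s ≤ upper t
    lower≉upper : ∀ {s t} → s ⊏ t → ¬ (lower s ≈ upper t)
    lower≰upper : ∀ s {t} → (s ∷ʳ false) ⊑ᵖ t → ¬ (lower (s ∷ʳ true) ≤ upper t)

openSplit-fork : {Q : Poset a ℓ₁ ℓ₂} → Fork Q → Fork (openSplit Q)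
openSplit-fork F = record
  { lower       = λ s → lower s , false
  ; upper       = λ t → upper t , true
  ; lower≤upper = λ s⊏t → inj₁ ((lower≤upper s⊏t , lower≉upper s⊏t) , f<t)
  ; lower≉upper = λ { _ (_ , ()) }
  -- The second components exclude equality of the pairs, so only the strict case is left.
  ; lower≰upper = λ { s s0⊑t (inj₁ ((le , _) , _)) → lower≰upper s s0⊑t le }
  }
  where open Fork F

-- The word s encodes an interval nested in (p , q); left s is its left end and inner s a point inside.
left inner : Word → ∀ {p q} → p ℚ.< q → ℚ
left []          {p} p<q = p
left (false ∷ s) p<q = left s (proj₁ (proj₂ (ℚ.<-dense p<q)))
left (true  ∷ s) p<q = left s (proj₂ (proj₂ (ℚ.<-dense p<q)))
inner []          p<q = proj₁ (ℚ.<-dense p<q)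
inner (false ∷ s) p<q = inner s (proj₁ (proj₂ (ℚ.<-dense p<q)))
inner (true  ∷ s) p<q = inner s (proj₂ (proj₂ (ℚ.<-dense p<q)))

≤-left : ∀ s {p q} (p<q : p ℚ.< q) → p ℚ.≤ left s p<q
≤-left []          p<q = ℚ.≤-refl
≤-left (false ∷ s) p<q = ≤-left s _
≤-left (true  ∷ s) p<q = let _ , p<m , m<q = ℚ.<-dense p<q in ℚ.≤-trans (ℚ.<⇒≤ p<m) (≤-left s m<q)

inner< : ∀ s {p q} (p<q : p ℚ.< q) → inner s p<q ℚ.< q
inner< []          p<q = proj₂ (proj₂ (ℚ.<-dense p<q))
inner< (false ∷ s) p<q = let _ , p<m , m<q = ℚ.<-dense p<q in ℚ.<-trans (inner< s p<m) m<q
inner< (true  ∷ s) p<q = inner< s _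

left<inner : ∀ {s t p q} (p<q : p ℚ.< q) → s ⊑ᵖ t → left s p<q ℚ.< inner t p<q
left<inner {t = []}        p<q [] = proj₁ (proj₂ (ℚ.<-dense p<q))
left<inner {t = false ∷ t} p<q [] = left<inner {t = t} (proj₁ (proj₂ (ℚ.<-dense p<q))) []
left<inner {t = true  ∷ t} p<q [] =
  let _ , p<m , m<q = ℚ.<-dense p<q in ℚ.<-trans p<m (left<inner {t = t} m<q [])
left<inner {false ∷ s} p<q (refl ∷ s⊑t) = left<inner _ s⊑t
left<inner {true  ∷ s} p<q (refl ∷ s⊑t) = left<inner _ s⊑t

-- The intervals of `s0` and `s1` meet at `inner s`, where the second one starts.
inner<left : ∀ s {t p q} (p<q : p ℚ.< q) → (s ∷ʳ false) ⊑ᵖ t → inner t p<q ℚ.< left (s ∷ʳ true) p<q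
inner<left []          {_ ∷ t} p<q (refl ∷ _)    = inner< t _
inner<left (false ∷ s) p<q (refl ∷ s0⊑t) = inner<left s _ s0⊑t
inner<left (true  ∷ s) p<q (refl ∷ s0⊑t) = inner<left s _ s0⊑t

left-mono-⊑ : ∀ {s t p q} (p<q : p ℚ.< q) → s ⊑ᵖ t → left s p<q ℚ.≤ left t p<q
left-mono-⊑ {t = t}     p<q []           = ≤-left t p<q
left-mono-⊑ {false ∷ s} p<q (refl ∷ s⊑t) = left-mono-⊑ _ s⊑t
left-mono-⊑ {true  ∷ s} p<q (refl ∷ s⊑t) = left-mono-⊑ _ s⊑t

left-mono-lex : ∀ {s t p q} (p<q : p ℚ.< q) → s ≤ˡᵉˣ t → left s p<q ℚ.≤ left t p<q
left-mono-lex p<q (base _) = ℚ.≤-refl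
left-mono-lex {t = t} p<q halt = ≤-left t p<q
left-mono-lex {false ∷ s} {true ∷ t} p<q (this f<t) =
  let _ , p<m , m<q = ℚ.<-dense p<q
  in  ℚ.≤-trans (ℚ.<⇒≤ (ℚ.<-trans (left<inner {s} p<m ⊑ᵖ.refl) (inner< s p<m))) (≤-left t m<q)
left-mono-lex {false ∷ s} p<q (next refl s≤t) = left-mono-lex _ s≤t
left-mono-lex {true  ∷ s} p<q (next refl s≤t) = left-mono-lex _ s≤t

-- Though not injective (a word and its extension by `false` share a left end), this monotone map
-- allows comparisons in `Ωη` to be refuted in `ℚ`.
left-mono-Ω : ∀ {s t p q} (p<q : p ℚ.< q) → s ≤Ω t → left s p<q ℚ.≤ left t p<q
left-mono-Ω p<q Star.ε                       = ℚ.≤-refl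
left-mono-Ω p<q (inj₁ s⊑u Star.◅ u≤t)       = ℚ.≤-trans (left-mono-⊑ p<q s⊑u) (left-mono-Ω p<q u≤t)
left-mono-Ω p<q (inj₂ (_ , s≤u) Star.◅ u≤t) = ℚ.≤-trans (left-mono-lex p<q s≤u) (left-mono-Ω p<q u≤t)

0<1 : 0ℚ ℚ.< 1ℚ
0<1 = ℚ.positive⁻¹ 1ℚ

η-fork : Fork η
η-fork = record
  { lower       = λ s → left s 0<1
  ; upper       = λ t → inner t 0<1
  ; lower≤upper = λ s⊏t → ℚ.<⇒≤ (left<inner 0<1 (⊏⇒⊑ s⊏t))
  ; lower≉upper = λ s⊏t → ℚ.<⇒≢ (left<inner 0<1 (⊏⇒⊑ s⊏t))
  ; lower≰upper = λ s s0⊑t le → ℚ.<-irrefl refl (ℚ.<-≤-trans (inner<left s 0<1 s0⊑t) le)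
  }

T₂-fork : Fork T₂
T₂-fork = record
  { lower       = λ s → s
  ; upper       = λ t → t
  ; lower≤upper = ⊏⇒⊑
  ; lower≉upper = ⊏⇒≢
  ; lower≰upper = siblings-disjoint
  }

Ωη-fork : Fork Ωη
Ωη-fork = record
  { lower       = λ s → s
  ; upper       = λ t → t
  ; lower≤upper = λ s⊏t → inj₁ (⊏⇒⊑ s⊏t) Star.◅ Star.ε
  ; lower≉upper = ⊏⇒≢
  -- Applying `left` to `s1 ≤ t` would give `left t < inner t < left s1 ≤ left t`.
  ; lower≰upper = λ s {t} s0⊑t s1≤t → ℚ.<-irrefl refl (ℚ.<-≤-trans
      (ℚ.<-trans (left<inner {t} 0<1 ⊑ᵖ.refl) (inner<left s 0<1 s0⊑t))
      (left-mono-Ω 0<1 s1≤t))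
  }

-- Forks and intersections of scattered chains

module _ {c} (em : ExcludedMiddle (c ⊔ ℓ₁ ⊔ ℓ₂ ⊔ ℓ₃)) (P : Poset c ℓ₁ ℓ₂)
         (n : ℕ) (L : Fin n → Rel (Poset.Carrier P) ℓ₃)
         (S : ∀ i → IsScatteredLinearOrder (Poset._≈_ P) (L i))
         (∩L : ∀ x y → Poset._≤_ P x y ⇔ (∀ i → L i x y)) where

  fork⇒¬↪ : ∀ {q₁ q₂ q₃} {Q : Poset q₁ q₂ q₃} → Fork Q → ¬ (Q ↪ P)
  fork⇒¬↪ F (e , isMono) =
    let s , _ , recurrent = common-extension n (λ i → Recurrent (L i) f) (λ i → Recurrent-up (L i) f)
          -- Excluded middle is lowered to the level of the `L i` through `Lift`.
          [] (λ i {s} _ → recurrent-dense (map′ Lift.lower (lift {ℓ = c ⊔ ℓ₁ ⊔ ℓ₂}) em) (S i) f s)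
        -- Recurrence at `s`, taken with `x = s1` and any `t` above `s0`, makes overtaking `s1`
        -- dense above `s0`.
        y , s0⊑y , overtaken = common-extension n (λ i → Overtakes (L i) f (s ∷ʳ true))
          (λ i → Overtakes-up (L i) f)
          (s ∷ʳ false) (λ i s0⊑t → recurrent i (⊑-∷ʳ s) (⊑ᵖ.trans (⊑-∷ʳ s) s0⊑t))
    -- The witness `z` depends on the chain but `y` does not, so `upper y` serves all chains at
    -- once.
    in lower≰upper s s0⊑y (cancel (Equivalence.from (∩L _ _) λ i →
         let z , z⊏y , x≤z = overtaken i
         in  IsScatteredLinearOrder.isTotalOrder (S i) .IsTotalOrder.trans x≤z
               (Equivalence.to (∩L _ _) (mono (lower≤upper z⊏y)) i)))
    where
    open Fork F
    open IsOrderMonomorphism isMono using (mono; cancel)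

    f : Word → Poset.Carrier P
    f = e ∘ lower

-- Duality

neg-cancel-≤ : ∀ {p q} → ℚ.- p ℚ.≤ ℚ.- q → q ℚ.≤ p
neg-cancel-≤ {p} {q} -p≤-q = ℚ.≮⇒≥ λ p<q → ℚ.<-irrefl refl (ℚ.<-≤-trans (ℚ.neg-antimono-< p<q) -p≤-q)

-- Negation reverses `ℚ`, so precomposing with it turns a copy of `η` in the reversed chain into one
-- in the chain itself.
flip-scattered : {A : Set a} {_≈_ : Rel A ℓ₁} {_≤_ : Rel A ℓ₂} →
                 IsScatteredLinearOrder _≈_ _≤_ → IsScatteredLinearOrder _≈_ (flip _≤_)
flip-scattered S = record
  { isTotalOrder = Flip.isTotalOrder isTotalOrder
  ; scattered    = λ (e , isMono) → let module e = IsOrderMonomorphism isMono in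
      scattered (e ∘ (ℚ.-_) , record
        { isOrderHomomorphism = record
          { cong = e.cong ∘ cong (ℚ.-_)
          ; mono = e.mono ∘ ℚ.neg-antimono-≤
          }
        ; injective = ℚ.neg-injective ∘ e.injective
        ; cancel    = neg-cancel-≤ ∘ e.cancel
        })
  }
  where open IsScatteredLinearOrder S

dual-↪ : ∀ {q₁ q₂ q₃ c} (Q : Poset q₁ q₂ q₃) (P : Poset c ℓ₁ ℓ₂) → dual Q ↪ P → Q ↪ dual P
dual-↪ Q P (e , isMono) = e , record
  { isOrderHomomorphism = record { cong = e.cong ; mono = e.mono }
  ; injective           = e.injective
  ; cancel              = e.cancel
  }
  where module e = IsOrderMonomorphism isMono

theorem1 : ∀ {c ℓ₁ ℓ₂ ℓ₃ : Level} → ExcludedMiddle (c ⊔ ℓ₁ ⊔ ℓ₂ ⊔ ℓ₃) →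
    (P : Poset c ℓ₁ ℓ₂) → let open Poset P in
    (n : ℕ) (L : Fin n → Rel Carrier ℓ₃) →
    (∀ i → IsScatteredLinearOrder _≈_ (L i)) →
    (∀ x y → x ≤ y ⇔ (∀ i → L i x y)) →
    All (λ Q → ¬ (Q ↪ P) × ¬ (dual Q ↪ P)) obstructions
theorem1 em P n L S ∩L =
  avoid η-fork ∷ avoid T₂-fork ∷ avoid Ωη-fork ∷
  avoid (openSplit-fork η-fork) ∷ avoid (openSplit-fork T₂-fork) ∷ avoid (openSplit-fork Ωη-fork) ∷ []
  where
  avoid : {Q : Poset 0ℓ 0ℓ 0ℓ} → Fork Q → ¬ (Q ↪ P) × ¬ (dual Q ↪ P)
  avoid {Q} F = fork⇒¬↪ em P n L S ∩L F ,
    -- `dual P` is the intersection of the reversed chains.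
    (λ dualQ↪P → fork⇒¬↪ em (dual P) n (flip ∘ L) (flip-scattered ∘ S) (flip ∩L) F (dual-↪ Q P dualQ↪P))
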